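{- Let $r\ge 2$ and let $Q\subseteq P(r)$ be a set of partitions of $r$ such that $M=(r)\in Q$ or $R=(1,1,\ldots,1)\in Q$, and such that $Q$ is not robust. Then there exist positive integers $n,q$ and a set $\Sigma\subseteq P(r)$ such that the $\Sigma$-hypergraph $H(n,r,q\mid\Sigma)$ has a gap in its $Q$-spectrum.
   Context: $P(r)$ denotes the set of all partitions of $r$ (multisets of positive integers summing to $r$). For $\Sigma\subseteq P(r)$ and positive integers $n,q$, the $\Sigma$-hypergraph $H(n,r,q\mid\Sigma)$ is the $r$-uniform hypergraph whose vertex set is partitioned into $n$ classes $V_1,\ldots,V_n$ of $q$ vertices each, in which an $r$-subset $K$ of vertices is an edge iff the partition of $r$ formed by the nonzero numbers $|K\cap V_i|$ belongs to $\Sigma$. Given a vertex colouring, the pattern $pat(E)$ of an edge $E$ is the partition of $r$ formed by the numbers of vertices of $E$ of each colour present in $E$. A $Q$-colouring is a vertex colouring with $pat(E)\in Q$ for all edges $E$; a $k$-$Q$-colouring is a $Q$-colouring using exactly $k$ colours. The $Q$-spectrum of $H$ is the set of all $k$ such that $H$ has a $k$-$Q$-colouring; it has a gap if there are integers $k_1<k_2<k_3$ with $k_1,k_3$ in the spectrum and $k_2$ not. A partition $\pi$ is obtained from $\sigma$ by reduction if $\pi$ arises by replacing two parts $a_i,a_j$ of $\sigma$ (at distinct positions) by the single part $a_i+a_j$; by expansion if $\pi$ arises by replacing a part $a_j\ge 2$ of $\sigma$ by the two parts $a_j-1$ and $1$. $Q$ is reduction-closed if every partition obtained by a reduction from a member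 of $Q$ lies in $Q$, and expansion-closed if every partition obtained by an expansion from a member of $Q$ lies in $Q$. $Q$ is simply-closed if $Q$ contains all partitions $(r-j,1,\ldots,1)$ (with $j$ parts equal to $1$ after the first) for $0\le j\le r-1$, i.e. $(r),(r-1,1),(r-2,1,1),\ldots,(1,\ldots,1)$. $Q$ is robust if it is reduction-closed, expansion-closed, or simply-closed. -}

module Defs where

open import Data.Nat using (ℕ; zero; suc; _+_; _∸_; _≤_; _<_; _≥_; _≟_)
open import Data.Bool using (Bool; true; false; if_then_else_)
open import Data.Fin using (Fin)
open import Data.List using (List; []; _∷_; replicate; filter; tabulate)
open import Data.Nat.ListAction using (sum)
open import Data.List.Relation.Unary.All using (All)
open import Data.List.Relation.Unary.Linked using (Linked)
open import Data.List.Relation.Binary.Permutation.Propositional using (_↭_)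
open import Data.Product using (Σ; ∃; _×_; _,_)
open import Data.Sum using (_⊎_)
open import Relation.Nullary using (¬_)
open import Relation.Nullary.Decidable using (¬?)
open import Relation.Binary.PropositionalEquality using (_≡_; _≢_)

IsPartition : ℕ → List ℕ → Set
IsPartition r xs = All (λ x → 1 ≤ x) xs × Linked _≥_ xs × sum xs ≡ r

-- A set of partitions is given by a Boolean predicate on lists; only its
-- values on canonical partitions of r matter.
PSet : Set
PSet = List ℕ → Bool

InSet : ℕ → PSet → List ℕ → Set
InSet r Q xs = Σ (List ℕ) λ π → IsPartition r π × Q π ≡ true × π ↭ xs

Reduction : List ℕ → List ℕ → Set
Reduction σ π = Σ ℕ λ a → Σ ℕ λ b → Σ (List ℕ) λ rest →
  (σ ↭ a ∷ b ∷ rest) × (π ↭ (a + b) ∷ rest)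

Expansion : List ℕ → List ℕ → Set
Expansion σ π = Σ ℕ λ a → Σ (List ℕ) λ rest →
  2 ≤ a × (σ ↭ a ∷ rest) × (π ↭ (a ∸ 1) ∷ 1 ∷ rest)

ReductionClosed : ℕ → PSet → Set
ReductionClosed r Q = ∀ σ π → IsPartition r σ → IsPartition r π →
  Q σ ≡ true → Reduction σ π → Q π ≡ true

ExpansionClosed : ℕ → PSet → Set
ExpansionClosed r Q = ∀ σ π → IsPartition r σ → IsPartition r π →
  Q σ ≡ true → Expansion σ π → Q π ≡ true

SimplyClosed : ℕ → PSet → Set
SimplyClosed r Q = ∀ j → j < r → Q ((r ∸ j) ∷ replicate j 1) ≡ true

Robust : ℕ → PSet → Set
Robust r Q = ReductionClosed r Q ⊎ ExpansionClosed r Q ⊎ SimplyClosed r Q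

countF : {m : ℕ} → (Fin m → Bool) → ℕ
countF {m} f = sum (tabulate {n = m} (λ i → if f i then 1 else 0))

nonzeros : List ℕ → List ℕ
nonzeros = filter (λ x → ¬? (x ≟ 0))

-- Vertices of H(n,r,q|Σ): pairs (i , j) with i : Fin n the class, j : Fin q.
-- A vertex subset is a characteristic function.
VSub : ℕ → ℕ → Set
VSub n q = Fin n → Fin q → Bool

size : {n q : ℕ} → VSub n q → ℕ
size {n} K = sum (tabulate {n = n} (λ i → countF (K i)))

classCounts : {n q : ℕ} → VSub n q → List ℕ
classCounts {n} K = nonzeros (tabulate {n = n} (λ i → countF (K i)))

IsEdge : (n r q : ℕ) → PSet → VSub n q → Set
IsEdge n r q Sig K = size K ≡ r × InSet r Sig (classCounts K)

Colouring : ℕ → ℕ → ℕ → Set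
Colouring n q k = Fin n → Fin q → Fin k

UsesAll : {n q k : ℕ} → Colouring n q k → Set
UsesAll {n} {q} {k} c = (a : Fin k) → Σ (Fin n) λ i → Σ (Fin q) λ j → c i j ≡ a

colourCount : {n q k : ℕ} → Colouring n q k → VSub n q → Fin k → ℕ
colourCount {n} c K a =
  sum (tabulate {n = n} (λ i → countF (λ j → if K i j then isA (c i j) else false)))
  where
    open import Data.Fin using () renaming (_≟_ to _≟F_)
    open import Relation.Nullary.Decidable using (⌊_⌋)
    isA : _ → Bool
    isA x = ⌊ x ≟F a ⌋

pattern' : {n q k : ℕ} → Colouring n q k → VSub n q → List ℕ
pattern' {k = k} c K = nonzeros (tabulate {n = k} (colourCount c K))

InSpectrum : (n r q : ℕ) → PSet → PSet → ℕ → Set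
InSpectrum n r q Sig Q k = Σ (Colouring n q k) λ c → UsesAll c ×
  ((K : VSub n q) → IsEdge n r q Sig K → InSet r Q (pattern' c K))

HasGap : (n r q : ℕ) → PSet → PSet → Set
HasGap n r q Sig Q = Σ ℕ λ k₁ → Σ ℕ λ k₂ → Σ ℕ λ k₃ →
  k₁ < k₂ × k₂ < k₃ × InSpectrum n r q Sig Q k₁ ×
  ¬ InSpectrum n r q Sig Q k₂ × InSpectrum n r q Sig Q k₃

{-# OPTIONS --safe #-}

-- Σ = Q throughout, and q is so large that every class i has a dominant colour D i, one
-- occurring at least r times in it; n is large too.  The gap sits
-- at a number k of colours for which a proper colouring would force Q to be robust.
-- * M, R ∈ Q: one class, k = r.  A dominant colour with j vertices of other colours has
--   pattern (r-j,1^j), so all hooks are in Q.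
-- * M ∈ Q, R ∉ Q: k = n-1 lies between 1 and n.  Take consecutive hooks with (r-j,1^j) ∈ Q and
--   (r-j-1,1^(j+1)) ∉ Q.  A class with two colours yields an edge with the latter pattern,
--   of type M or (r-j,1^j) according to whether many colours share a class or not.  So
--   all classes are monochromatic, two of them have the same colour, and letting
--   them take the parts a, b of an edge realises every reduction.
-- * R ∈ Q, M ∉ Q: k = n+1 lies between n and nq.  Take (r-j-1,1^(j+1)) ∈ Q and (r-j,1^j) ∉ Q.  If
--   D A = D B with A ≠ B, an edge of type R or (r-j-1,1^(j+1)) has pattern M or (r-j,1^j).
--   So D is injective and misses a colour; a vertex of it splits a part a into a-1 and 1.
module Submission where

open import Defs
open import Data.Bool as Bool using (Bool; true; false; if_then_else_; _∧_; _∨_)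
open import Data.Bool.Properties using (¬-not; not-¬)
open import Data.Empty using (⊥; ⊥-elim)
open import Data.Fin using (Fin; zero; suc; combine; remQuot)
open import Data.Fin.Properties
  using (any?; all?; ¬∀⟶∃¬; injective⇒≤; pigeonhole; combine-remQuot; remQuot-combine)
  renaming (_≟_ to _≟F_; suc-injective to suc-injectiveF; <⇒≢ to <⇒≢F)
open import Data.List
  using (List; []; _∷_; _++_; length; map; replicate; tabulate; filter; take; zipWith; allFin)
open import Data.List.Membership.DecPropositional using () renaming (_∈?_ to mem?)
open import Data.List.Membership.Propositional using (_∈_)
open import Data.List.Membership.Propositional.Properties using (∈-filter⁻)
open import Data.List.Properties
  using (++-identityʳ; filter-all; length-map; length-replicate; length-tabulate; length-take;
         map-++; map-cong; map-id; map-∘; tabulate-cong)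
open import Data.List.Relation.Binary.Permutation.Propositional
  using (_↭_; ↭-refl; ↭-reflexive; ↭-sym; ↭-trans; prep; swap; ↭⇒↭ₛ)
open import Data.List.Relation.Binary.Permutation.Propositional.Properties using (All-resp-↭)
open import Data.List.Relation.Binary.Pointwise using (Pointwise-≡⇒≡)
open import Data.List.Relation.Unary.All as All using (All; []; _∷_)
import Data.List.Relation.Unary.All.Properties as All
open import Data.List.Relation.Unary.AllPairs as AllPairs using (AllPairs; []; _∷_)
import Data.List.Relation.Unary.AllPairs.Properties as AllPairs
open import Data.List.Relation.Unary.Any using (here; there)
open import Data.List.Relation.Unary.Linked using (Linked; [-]; _∷_)
open import Data.List.Relation.Unary.Sorted.TotalOrder.Properties using (↗↭↗⇒≋)
open import Data.List.Relation.Unary.Unique.Propositional using (Unique)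
import Data.List.Relation.Unary.Unique.Propositional.Properties as Unique
open import Data.Nat using (ℕ; zero; suc; _+_; _*_; _∸_; _≤_; _<_; _≥_; z≤n; s≤s; _≤?_)
open import Data.Nat.ListAction using (sum)
open import Data.Nat.ListAction.Properties using (sum-↭; sum-++)
open import Data.Nat.Properties hiding (_≟_; _≤?_)
open import Algebra.Properties.CommutativeSemigroup +-commutativeSemigroup using (interchange)
open import Data.Product using (Σ; ∃; _×_; _,_; proj₁; proj₂)
open import Data.Sum using (_⊎_; inj₁; inj₂)
open import Function using (_∘_; id)
open import Relation.Binary using (DecidableEquality)
import Relation.Binary.Construct.Flip.EqAndOrd as Flip
open import Relation.Binary.PropositionalEquality
  using (_≡_; _≢_; refl; sym; trans; cong; cong₂; subst; module ≡-Reasoning)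
open import Relation.Nullary using (¬_; Dec; yes; no; does; contradiction)
open import Relation.Nullary.Decidable
  using (⌊_⌋; ¬?; _×-dec_; dec-true; dec-false; decidable-stable)

private variable
  m n q k r : ℕ
  Q : PSet
  A B : Set

_∈?_ : (j : Fin q) (js : List (Fin q)) → Dec (j ∈ js)
_∈?_ = mem? _≟F_

-- Sums over `Fin m` and counting of Boolean functions.

∑ : (Fin m → ℕ) → ℕ
∑ f = sum (tabulate f)

∑-cong : {f g : Fin m → ℕ} → (∀ i → f i ≡ g i) → ∑ f ≡ ∑ g
∑-cong eq = cong sum (tabulate-cong eq)

∑-zero : {f : Fin m → ℕ} → (∀ i → f i ≡ 0) → ∑ f ≡ 0
∑-zero {zero}  eq = refl
∑-zero {suc m} eq = cong₂ _+_ (eq zero) (∑-zero (eq ∘ suc))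

∑-+ : (f g : Fin m → ℕ) → ∑ (λ i → f i + g i) ≡ ∑ f + ∑ g
∑-+ {zero}  f g = refl
∑-+ {suc m} f g = trans (cong (f zero + g zero +_) (∑-+ (f ∘ suc) (g ∘ suc)))
                        (interchange (f zero) (g zero) _ _)

∑-single : {f : Fin m → ℕ} (x : Fin m) → (∀ i → i ≢ x → f i ≡ 0) → ∑ f ≡ f x
∑-single {suc m} {f} zero h =
  trans (cong (f zero +_) (∑-zero (λ i → h (suc i) λ ()))) (+-identityʳ _)
∑-single {suc m} {f} (suc x) h =
  cong₂ _+_ (h zero λ ()) (∑-single x (λ i ne → h (suc i) (ne ∘ suc-injectiveF)))

∑-swap : (f : Fin m → Fin n → ℕ) → ∑ (λ i → ∑ (f i)) ≡ ∑ (λ j → ∑ (λ i → f i j))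
∑-swap {zero} {n} f = sym (∑-zero {n} (λ _ → refl))
∑-swap {suc m} f = trans (cong (∑ (f zero) +_) (∑-swap (f ∘ suc)))
                         (sym (∑-+ (f zero) (λ j → ∑ (λ i → f (suc i) j))))

countF-cong : {f g : Fin m → Bool} → (∀ i → f i ≡ g i) → countF f ≡ countF g
countF-cong eq = ∑-cong (λ i → cong (if_then 1 else 0) (eq i))

countF-none : {f : Fin m → Bool} → (∀ i → f i ≡ false) → countF f ≡ 0
countF-none eq = ∑-zero (λ i → cong (if_then 1 else 0) (eq i))

countF-∨ : (f g : Fin m → Bool) → (∀ j → f j ≡ true → g j ≡ true → ⊥) →
  countF (λ j → f j ∨ g j) ≡ countF f + countF g
countF-∨ {m} f g disj = trans (∑-cong step) (∑-+ {m} _ _)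
  where
  step : ∀ j → (if f j ∨ g j then 1 else 0) ≡ (if f j then 1 else 0) + (if g j then 1 else 0)
  step j with f j | g j | disj j
  ... | true  | true  | d = ⊥-elim (d refl refl)
  ... | true  | false | _ = refl
  ... | false | _     | _ = refl

countF-≟ : (x : Fin m) → countF (λ j → does (j ≟F x)) ≡ 1
countF-≟ x = trans
  (∑-single x (λ i ne → cong (if_then 1 else 0) (dec-false (i ≟F x) ne)))
  (cong (if_then 1 else 0) (dec-true (x ≟F x) refl))

does⁻ : {P : Set} (d : Dec P) → does d ≡ true → P
does⁻ (yes p) _ = p

countF-∈ : {js : List (Fin q)} → Unique js → countF (λ j → does (j ∈? js)) ≡ length js
countF-∈ {q} {[]} [] = countF-none {q} (λ _ → refl)
countF-∈ {js = x ∷ js} (x∉ ∷ u) = trans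
  (countF-∨ (λ j → does (j ≟F x)) (λ j → does (j ∈? js)) λ j p p′ →
     All.All¬⇒¬Any x∉ (subst (_∈ js) (does⁻ (j ≟F x) p) (does⁻ (j ∈? js) p′)))
  (cong₂ _+_ (countF-≟ x) (countF-∈ u))

-- Nonzero counts and totals by key.

nonzeros-∷ : ∀ {x xs} → 1 ≤ x → nonzeros (x ∷ xs) ≡ x ∷ nonzeros xs
nonzeros-∷ {suc x} _ = refl

sum-nonzeros : ∀ xs → sum (nonzeros xs) ≡ sum xs
sum-nonzeros []           = refl
sum-nonzeros (zero ∷ xs)  = sum-nonzeros xs
sum-nonzeros (suc x ∷ xs) = cong (suc x +_) (sum-nonzeros xs)

nonzeros-01 : ∀ {xs} → All (_≤ 1) xs → nonzeros xs ≡ replicate (sum xs) 1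
nonzeros-01 [] = refl
nonzeros-01 (_∷_ {zero} _ h) = nonzeros-01 h
nonzeros-01 (_∷_ {suc zero} _ h) = cong (1 ∷_) (nonzeros-01 h)
nonzeros-01 (_∷_ {suc (suc _)} (s≤s ()) h)

nonzeros-zero : ∀ m → nonzeros (tabulate {n = m} (λ _ → 0)) ≡ []
nonzeros-zero zero    = refl
nonzeros-zero (suc m) = nonzeros-zero m

-- Away from `x` both lists keep the same entries; at `x` only `f` keeps one. Its place in the list
-- depends on `x`, hence `↭`.
nonzeros-insert : (f g : Fin m → ℕ) (x : Fin m) → 1 ≤ f x → g x ≡ 0 →
  (∀ i → i ≢ x → f i ≡ g i) → nonzeros (tabulate f) ↭ f x ∷ nonzeros (tabulate g)
nonzeros-insert {suc m} f g zero 1≤ g0 eq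
  rewrite nonzeros-∷ {xs = tabulate (f ∘ suc)} 1≤ | g0
        | tabulate-cong {f = f ∘ suc} {g = g ∘ suc} (λ i → eq (suc i) λ ()) = ↭-refl
nonzeros-insert {suc m} f g (suc x) 1≤ gx eq
  with g zero | eq zero (λ ()) | nonzeros-insert (f ∘ suc) (g ∘ suc) x 1≤ gx
                                   (λ i ne → eq (suc i) (ne ∘ suc-injectiveF))
... | zero  | f0 | ih rewrite f0 = ih
... | suc z | f0 | ih rewrite f0 = ↭-trans (prep _ ih) (swap _ _ ↭-refl)

-- `key` is instantiated with the class and with the colour of a block, so that the type and the
-- pattern of an edge come from the same computations.
module Totals {B : Set} (mult : B → ℕ) (key : B → Fin m) where

  total : List B → Fin m → ℕ
  total bs x = sum (map (λ b → if does (key b ≟F x) then mult b else 0) bs)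

  total-++ : ∀ bs bs′ x → total (bs ++ bs′) x ≡ total bs x + total bs′ x
  total-++ bs bs′ x = trans (cong sum (map-++ _ bs bs′)) (sum-++ (map _ bs) _)

  total-∉ : ∀ {bs x} → All (λ b → key b ≢ x) bs → total bs x ≡ 0
  total-∉ [] = refl
  total-∉ {b ∷ bs} {x} (ne ∷ h) rewrite dec-false (key b ≟F x) ne = total-∉ h

  total-all : ∀ {bs x} → All (λ b → key b ≡ x) bs → total bs x ≡ sum (map mult bs)
  total-all [] = refl
  total-all {b ∷ bs} {x} (eq ∷ h) rewrite dec-true (key b ≟F x) eq = cong (mult b +_) (total-all h)

  Counts : List B → List ℕ → Set
  Counts bs σ = nonzeros (tabulate (total bs)) ↭ σ

  -- The total at `x` comes from `bs` alone and every other total from `bs′` alone, so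
  -- `nonzeros-insert` adds exactly one part.
  counts-group : ∀ {bs bs′ x σ} → All (λ b → key b ≡ x) bs → All (λ b → key b ≢ x) bs′ →
    1 ≤ sum (map mult bs) → Counts bs′ σ → Counts (bs ++ bs′) (sum (map mult bs) ∷ σ)
  counts-group {bs} {bs′} {x} same other pos cs = ↭-trans
    (nonzeros-insert _ (total bs′) x (subst (1 ≤_) (sym at) pos) (total-∉ other)
      (λ i ne → trans (total-++ bs bs′ i)
        (cong (_+ total bs′ i) (total-∉ (All.map (λ { refl → ne ∘ sym }) same)))))
    (↭-trans (↭-reflexive (cong (_∷ _) at)) (prep _ cs))
    where
    at : total (bs ++ bs′) x ≡ sum (map mult bs)
    at = trans (total-++ bs bs′ x)
           (trans (cong₂ _+_ (total-all same) (total-∉ other)) (+-identityʳ _))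

  counts-[] : Counts [] []
  counts-[] = ↭-reflexive (nonzeros-zero m)

  counts-constant : ∀ {bs x} → All (λ b → key b ≡ x) bs → 1 ≤ sum (map mult bs) →
    Counts bs (sum (map mult bs) ∷ [])
  counts-constant {bs} same pos = subst (λ l → Counts l (sum (map mult bs) ∷ [])) (++-identityʳ bs)
    (counts-group same [] pos counts-[])

  counts-unique : ∀ {bs} → Unique (map key bs) → All (1 ≤_) (map mult bs) →
    Counts bs (map mult bs)
  counts-unique {[]} _ _ = counts-[]
  counts-unique {b ∷ bs} (fresh ∷ u) (pos ∷ ps) =
    subst (λ s → Counts (b ∷ bs) (s ∷ map mult bs)) (+-identityʳ _)
      (counts-group {bs = b ∷ []} (refl ∷ []) (All.map (λ ne → ne ∘ sym) (All.map⁻ fresh))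
        (subst (1 ≤_) (sym (+-identityʳ _)) pos) (counts-unique u ps))

  -- The only place where two parts are added: read by colour it gives `forced-merge`, read by class
  -- it gives `forced-split`.
  counts-pair : ∀ {b b′ bs} → key b ≡ key b′ → Unique (map key (b′ ∷ bs)) →
    All (1 ≤_) (map mult (b ∷ b′ ∷ bs)) →
    Counts (b ∷ b′ ∷ bs) (mult b + mult b′ ∷ map mult bs)
  counts-pair {b} {b′} {bs} eq (fresh ∷ u) (1≤ ∷ _ ∷ ps) =
    subst (λ t → Counts (b ∷ b′ ∷ bs) (t ∷ map mult bs)) (cong (mult b +_) (+-identityʳ _))
      (counts-group {bs = b ∷ b′ ∷ []} (eq ∷ refl ∷ []) (All.map (λ ne → ne ∘ sym) (All.map⁻ fresh))
        (m≤n⇒m≤n+o _ 1≤) (counts-unique u ps))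

-- Edges are assembled from blocks (class, colour, positions); both their type and their
-- pattern are then read off the block sizes.
module Blocks (c : Colouring n q k) where

  record Block : Set where
    field
      cls    : Fin n
      col    : Fin k
      pos    : List (Fin q)
      unique : Unique pos
      mono   : ∀ {j} → j ∈ pos → c cls j ≡ col
    mult : ℕ
    mult = length pos
  open Block public

  -- A vertex has one class and one colour, so with `mono` either difference makes the blocks
  -- disjoint.
  Apart : Block → Block → Set
  Apart b b′ = cls b ≢ cls b′ ⊎ col b ≢ col b′

  inBlock : Block → VSub n q
  inBlock b i j = does (cls b ≟F i) ∧ does (j ∈? pos b)

  select : List Block → VSub n q
  select []       i j = false
  select (b ∷ bs) i j = inBlock b i j ∨ select bs i j

  ∧-true : ∀ {x y} → x ∧ y ≡ true → x ≡ true × y ≡ true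
  ∧-true {true} {true} _ = refl , refl

  inBlock⁻ : ∀ b {i j} → inBlock b i j ≡ true → cls b ≡ i × c i j ≡ col b
  inBlock⁻ b {i} {j} p with ∧-true {does (cls b ≟F i)} p
  ... | p₁ , p₂ with does⁻ (cls b ≟F i) p₁
  ... | refl = refl , mono b (does⁻ (j ∈? pos b) p₂)

  disjoint : ∀ b {bs i j} → All (Apart b) bs →
    inBlock b i j ≡ true → select bs i j ≡ true → ⊥
  disjoint b {b′ ∷ bs} {i} {j} (ap ∷ aps) p p′ with inBlock b′ i j in eq
  ... | false = disjoint b aps p p′
  ... | true with inBlock⁻ b p | inBlock⁻ b′ eq | ap
  ... | e , _ | e′ , _ | inj₁ ne = ne (trans e (sym e′))
  ... | _ , e | _ , e′ | inj₂ ne = ne (trans (sym e) e′)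

  module Cls = Totals mult cls
  module Col = Totals mult col

  weight : (Block → Bool) → Fin n → Block → ℕ
  weight p i b = if does (cls b ≟F i) ∧ p b then mult b else 0

  -- `P` is a vertex property constant on each block. The constant `true` yields class counts,
  -- having a fixed colour yields colour counts. Disjointness makes the contributions of the blocks
  -- additive.
  count-row : (P : VSub n q) (p : Block → Bool) →
    (∀ b {j} → j ∈ pos b → P (cls b) j ≡ p b) →
    ∀ {bs} → AllPairs Apart bs → ∀ i →
    countF (λ j → if select bs i j then P i j else false) ≡ sum (map (weight p i) bs)
  count-row P p Pp [] i = countF-none {q} (λ _ → refl)
  count-row P p Pp {b ∷ bs} (ap ∷ aps) i = trans (countF-cong distr)
    (trans (countF-∨ (λ j → inBlock b i j ∧ P i j) _ disj)
      (cong₂ _+_ (one (cls b ≟F i)) (count-row P p Pp aps i)))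
    where
    distr : ∀ j → (if select (b ∷ bs) i j then P i j else false) ≡
                  (inBlock b i j ∧ P i j) ∨ (if select bs i j then P i j else false)
    distr j with inBlock b i j | select bs i j | P i j
    ... | true  | true  | true  = refl
    ... | true  | true  | false = refl
    ... | true  | false | true  = refl
    ... | true  | false | false = refl
    ... | false | _     | _     = refl
    disj : ∀ j → inBlock b i j ∧ P i j ≡ true →
      (if select bs i j then P i j else false) ≡ true → ⊥
    disj j e e′ with select bs i j in eq
    ... | true = disjoint b ap (proj₁ (∧-true {inBlock b i j} e)) eq
    one : (d : Dec (cls b ≡ i)) → countF (λ j → (does d ∧ does (j ∈? pos b)) ∧ P i j) ≡
      (if does d ∧ p b then mult b else 0)
    one (no _) = countF-none {q} (λ _ → refl)
    one (yes refl) with p b in eq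
    ... | true = trans (countF-cong tt) (countF-∈ (unique b))
      where
      tt : ∀ j → does (j ∈? pos b) ∧ P (cls b) j ≡ does (j ∈? pos b)
      tt j with j ∈? pos b
      ... | yes j∈ = trans (Pp b j∈) eq
      ... | no _   = refl
    ... | false = countF-none ff
      where
      ff : ∀ j → does (j ∈? pos b) ∧ P (cls b) j ≡ false
      ff j with j ∈? pos b
      ... | yes j∈ = trans (Pp b j∈) eq
      ... | no _   = refl

  classCount-select : ∀ {bs} → AllPairs Apart bs → ∀ i →
    countF (select bs i) ≡ Cls.total bs i
  classCount-select {bs} ap i = trans (countF-cong triv)
    (trans (count-row (λ _ _ → true) (λ _ → true) (λ _ _ → refl) ap i) (drop bs))
    where
    triv : ∀ j → select bs i j ≡ (if select bs i j then true else false)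
    triv j with select bs i j
    ... | true  = refl
    ... | false = refl
    drop : ∀ bs → sum (map (weight (λ _ → true) i) bs) ≡ Cls.total bs i
    drop [] = refl
    drop (b ∷ bs) with does (cls b ≟F i)
    ... | true  = cong (mult b +_) (drop bs)
    ... | false = drop bs

  -- Once the sums over classes and over blocks are exchanged, each block contributes only in its
  -- own class, and there only if its colour is `a`.
  colourCount-select : ∀ {bs} → AllPairs Apart bs → ∀ a →
    colourCount c (select bs) a ≡ Col.total bs a
  colourCount-select {bs} ap a = trans
    (∑-cong (count-row (λ i j → ⌊ c i j ≟F a ⌋) (λ b → ⌊ col b ≟F a ⌋)
              (λ b j∈ → cong (λ x → ⌊ x ≟F a ⌋) (mono b j∈)) ap))
    (exchange bs)
    where
    p : Block → Bool
    p b = ⌊ col b ≟F a ⌋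
    single : ∀ b → ∑ (λ i → weight p i b) ≡ (if does (col b ≟F a) then mult b else 0)
    single b = trans (∑-single (cls b) off) on
      where
      off : ∀ i → i ≢ cls b → weight p i b ≡ 0
      off i ne rewrite dec-false (cls b ≟F i) (ne ∘ sym) = refl
      on : weight p (cls b) b ≡ (if does (col b ≟F a) then mult b else 0)
      on rewrite dec-true (cls b ≟F cls b) refl with col b ≟F a
      ... | yes _ = refl
      ... | no _  = refl
    exchange : ∀ bs → ∑ (λ i → sum (map (weight p i) bs)) ≡ Col.total bs a
    exchange [] = ∑-zero {n} (λ _ → refl)
    exchange (b ∷ bs) = trans
      (∑-+ (λ i → weight p i b) (λ i → sum (map (weight p i) bs)))
      (cong₂ _+_ (single b) (exchange bs))

-- Pigeonhole arguments for lists.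

countF-≤ : (f : Fin m → Bool) → countF f ≤ m
countF-≤ {zero}  f = z≤n
countF-≤ {suc m} f with f zero
... | true  = s≤s (countF-≤ (f ∘ suc))
... | false = m≤n⇒m≤1+n (countF-≤ (f ∘ suc))

unique-length : {js : List (Fin q)} → Unique js → length js ≤ q
unique-length {js = js} u = subst (_≤ _) (countF-∈ u) (countF-≤ (λ j → does (j ∈? js)))

Separated : (A → B) → List A → Set
Separated f = AllPairs (λ x y → f x ≢ f y)

separated⇒unique : {f : A → B} {xs : List A} → Separated f xs → Unique xs
separated⇒unique = AllPairs.map (λ ne → ne ∘ cong _)

module _ (_≟B_ : DecidableEquality B) where

  avoid : (A → B) → B → List A → List A
  avoid f b = filter (λ x → ¬? (f x ≟B b))

  avoid-All : (f : A → B) (b : B) (xs : List A) → All (λ x → f x ≢ b) (avoid f b xs)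
  avoid-All f b xs = All.all-filter (λ x → ¬? (f x ≟B b)) xs

  -- At most one element of a separated list has the value `b`. The constants in hypotheses such as
  -- `3 + j ≤ length as` pay for such losses.
  avoid-length : (f : A → B) (b : B) {xs : List A} → Separated f xs →
    length xs ≤ suc (length (avoid f b xs))
  avoid-length f b [] = z≤n
  avoid-length f b {x ∷ xs} (ne ∷ sep) with f x ≟B b
  ... | yes refl = s≤s (≤-reflexive (cong length (sym
                     (filter-all (λ y → ¬? (f y ≟B b)) (All.map (λ h → h ∘ sym) ne)))))
  ... | no _ = s≤s (avoid-length f b sep)

  length-fibre+avoid : (f : A → B) (b : B) (xs : List A) →
    length (filter (λ x → f x ≟B b) xs) + length (avoid f b xs) ≡ length xs
  length-fibre+avoid f b [] = refl
  length-fibre+avoid f b (x ∷ xs) with f x ≟B b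
  ... | yes _ = cong suc (length-fibre+avoid f b xs)
  ... | no _  = trans (+-suc _ _) (cong suc (length-fibre+avoid f b xs))

  -- Pigeonhole: either some fibre of f has suc s elements, or greedily discarding the fibre
  -- of each chosen element leaves room for m choices.
  constant⊎separated : (f : A → B) (s m : ℕ) (xs : List A) → Unique xs → m * suc s ≤ length xs →
    (∃ λ b → ∃ λ ys → Unique ys × length ys ≡ suc s × All (λ y → f y ≡ b) ys) ⊎
    (∃ λ ys → length ys ≡ m × Separated f ys × All (_∈ xs) ys)
  constant⊎separated f s zero xs u le = inj₂ ([] , refl , [] , [])
  constant⊎separated f s (suc m) (x ∷ xs) (x∉ ∷ u) (s≤s le)
    with s ≤? length (filter (λ y → f y ≟B f x) xs)
  ... | yes enough = inj₁
    ( f x , x ∷ take s fibre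
    , All.take⁺ s (All.filter⁺ (λ y → f y ≟B f x) x∉) ∷
      Unique.take⁺ s (Unique.filter⁺ (λ y → f y ≟B f x) u)
    , cong suc (trans (length-take s fibre) (m≤n⇒m⊓n≡m enough))
    , refl ∷ All.take⁺ s (All.all-filter (λ y → f y ≟B f x) xs) )
    where fibre = filter (λ y → f y ≟B f x) xs
  ... | no few
    with constant⊎separated f s m (avoid f (f x) xs) (Unique.filter⁺ _ u)
           (+-cancelˡ-≤ (length (filter (λ y → f y ≟B f x) xs)) _ _ (≤-trans
             (≤-trans (+-monoˡ-≤ (m * suc s) (<⇒≤ (≰⇒> few))) le)
             (≤-reflexive (sym (length-fibre+avoid f (f x) xs)))))
  ... | inj₁ const = inj₁ const
  ... | inj₂ (ys , len , sep , ys⊆) = inj₂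
    ( x ∷ ys , cong suc len
    , All.map (λ {y} y∈ eq → proj₂ (∈-filter⁻ (λ z → ¬? (f z ≟B f x)) {xs = xs} y∈) (sym eq)) ys⊆ ∷ sep
    , here refl ∷ All.map (λ y∈ → there (proj₁ (∈-filter⁻ (λ z → ¬? (f z ≟B f x)) {xs = xs} y∈))) ys⊆ )

-- Canonical partitions and hooks.

partition-unique : ∀ {π π′} → IsPartition r π → IsPartition r π′ → π ↭ π′ → π ≡ π′
partition-unique (_ , l , _) (_ , l′ , _) p = Pointwise-≡⇒≡
  (↗↭↗⇒≋ (Flip.totalOrder ≤-totalOrder) l l′ (↭⇒↭ₛ p))

-- A membership known up to `↭` determines `Q π` only because the canonical rearrangement of a list
-- is unique.
inSet⇒∈ : ∀ {xs π} → InSet r Q xs → xs ↭ π → IsPartition r π → Q π ≡ true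
inSet⇒∈ {Q = Q} (π′ , part′ , q , p) p′ part =
  subst (λ l → Q l ≡ true) (partition-unique part′ part (↭-trans p p′)) q

-- The lists in `SimplyClosed`, leading from M at `j = 0` to R at `j = r ∸ 1`.
hook : ℕ → ℕ → List ℕ
hook r j = (r ∸ j) ∷ replicate j 1

sum-ones : ∀ j → sum (replicate j 1) ≡ j
sum-ones zero    = refl
sum-ones (suc j) = cong suc (sum-ones j)

hook-partition : ∀ {j} → j < r → IsPartition r (hook r j)
hook-partition {r} {j} j<r =
    (m<n⇒0<n∸m j<r ∷ All.replicate⁺ j ≤-refl)
  , linked (m<n⇒0<n∸m j<r) j
  , trans (cong (r ∸ j +_) (sum-ones j)) (m∸n+n≡m (<⇒≤ j<r))
  where
  linked : ∀ {x} → 1 ≤ x → ∀ j → Linked _≥_ (x ∷ replicate j 1)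
  linked _  zero    = [-]
  linked 1≤ (suc j) = 1≤ ∷ linked ≤-refl j

hook-last : 1 ≤ r → hook r (r ∸ 1) ≡ replicate r 1
hook-last {suc r} _ = cong (_∷ replicate r 1) (m+n∸n≡m 1 r)

-- The search descends from `t`, so it finds the last step leaving `b` below `t`. Applied to hooks,
-- it yields two consecutive ones of which exactly one is in `Q`.
first-change : (f : ℕ → Bool) (b : Bool) (t : ℕ) → f 0 ≡ b → f t ≢ b →
  ∃ λ j → j < t × f j ≡ b × f (suc j) ≢ b
first-change f b zero    f0 ft = contradiction f0 ft
first-change f b (suc t) f0 ft with f t Bool.≟ b
... | yes e = t , ≤-refl , e , ft
... | no ne with first-change f b t f0 ne
... | j , lt , e = j , m≤n⇒m≤1+n lt , e

-- Numbers of colours that lie in the spectrum.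

Proper : (r : ℕ) (Q : PSet) → Colouring n q k → Set
Proper {n} {q} r Q c = (K : VSub n q) → IsEdge n r q Q K → InSet r Q (pattern' c K)

∑-colourCount : (c : Colouring n q k) (K : VSub n q) → ∑ (colourCount c K) ≡ size K
∑-colourCount {n} {q} {k} c K =
  trans (∑-swap λ a i → countF (ind i a)) (∑-cong λ i →
  trans (∑-swap λ a j → if ind i a j then 1 else 0) (∑-cong λ j → one i j))
  where
  ind : Fin n → Fin k → Fin q → Bool
  ind i a j = if K i j then ⌊ c i j ≟F a ⌋ else false
  one : ∀ i j → ∑ (λ a → if ind i a j then 1 else 0) ≡ (if K i j then 1 else 0)
  one i j = trans (∑-single (c i j) off) on
    where
    off : ∀ a → a ≢ c i j → (if ind i a j then 1 else 0) ≡ 0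
    off a ne with K i j
    ... | false = refl
    ... | true with c i j ≟F a
    ... | yes eq = contradiction (sym eq) ne
    ... | no _   = refl
    on : (if ind i (c i j) j then 1 else 0) ≡ (if K i j then 1 else 0)
    on with K i j
    ... | false = refl
    ... | true with c i j ≟F c i j
    ... | yes _ = refl
    ... | no ne = contradiction refl ne

constant-spectrum : 1 ≤ r → Q (r ∷ []) ≡ true → InSpectrum (suc n) r (suc q) Q Q 1
constant-spectrum {suc r} {Q} {n} {q} _ M = c , (λ { zero → zero , zero , refl }) , proper
  where
  c : Colouring (suc n) (suc q) 1
  c _ _ = zero
  proper : Proper (suc r) Q c
  proper K (size≡ , _) =
    suc r ∷ [] , hook-partition {suc r} (s≤s z≤n) , M
    , ↭-reflexive (cong (λ x → nonzeros (x ∷ []))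
        (sym (trans (sym (+-identityʳ _)) (trans (∑-colourCount c K) size≡))))

-- If each vertex is coloured by its class, the pattern of an edge is its type, which is in Σ = `Q`.
class-spectrum : InSpectrum n r (suc q) Q Q n
class-spectrum {n} {r} {q} {Q} = (λ i _ → i) , (λ a → a , zero , refl) , proper
  where
  count : (K : VSub n (suc q)) (a : Fin n) → colourCount (λ i _ → i) K a ≡ countF (K a)
  count K a = trans (∑-single a off) (countF-cong on)
    where
    off : ∀ i → i ≢ a → countF (λ j → if K i j then ⌊ i ≟F a ⌋ else false) ≡ 0
    off i ne with i ≟F a
    ... | yes eq = contradiction eq ne
    ... | no _   = countF-none λ j → lem (K i j)
      where
      lem : ∀ b → (if b then false else false) ≡ false
      lem true  = refl
      lem false = refl
    on : ∀ j → (if K a j then ⌊ a ≟F a ⌋ else false) ≡ K a j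
    on j with K a j | a ≟F a
    ... | true  | yes _ = refl
    ... | true  | no ne = contradiction refl ne
    ... | false | _     = refl
  proper : Proper r Q (λ i _ → i)
  proper K (_ , π , part , q∈ , p) =
    π , part , q∈ , ↭-trans p (↭-reflexive (cong nonzeros (tabulate-cong (λ a → sym (count K a)))))

-- `combine` gives every vertex its own colour, so all colour counts are at most 1; as they sum to
-- `r`, the pattern is R.
rainbow-spectrum : ∀ n q → 1 ≤ r → Q (replicate r 1) ≡ true → InSpectrum n r q Q Q (n * q)
rainbow-spectrum {r} {Q} n q 1≤r R = combine , surj , proper
  where
  surj : UsesAll (combine {n} {q})
  surj a = proj₁ (remQuot {n} q a) , proj₂ (remQuot {n} q a) , combine-remQuot {n} q a
  ≤1 : (K : VSub n q) (a : Fin (n * q)) → colourCount combine K a ≤ 1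
  ≤1 K a = subst (_≤ 1) (sym (trans (∑-single i₀ row) (∑-single j₀ cell))) bit
    where
    i₀ = proj₁ (remQuot {n} q a)
    j₀ = proj₂ (remQuot {n} q a)
    at : ∀ {i j} → combine i j ≡ a → i ≡ i₀ × j ≡ j₀
    at refl = sym (cong proj₁ (remQuot-combine {n} {q} _ _)) ,
              sym (cong proj₂ (remQuot-combine {n} {q} _ _))
    zero-unless : ∀ i j → ¬ (combine i j ≡ a) → (if K i j then ⌊ combine i j ≟F a ⌋ else false) ≡ false
    zero-unless i j ne with K i j
    ... | false = refl
    ... | true with combine i j ≟F a
    ... | yes eq = contradiction eq ne
    ... | no _   = refl
    row : ∀ i → i ≢ i₀ → countF (λ j → if K i j then ⌊ combine i j ≟F a ⌋ else false) ≡ 0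
    row i ne = countF-none (λ j → zero-unless i j (ne ∘ proj₁ ∘ at))
    cell : ∀ j → j ≢ j₀ → (if (if K i₀ j then ⌊ combine i₀ j ≟F a ⌋ else false) then 1 else 0) ≡ 0
    cell j ne = cong (if_then 1 else 0) (zero-unless i₀ j (ne ∘ proj₂ ∘ at))
    bit : ∀ {b} → (if b then 1 else 0) ≤ 1
    bit {true}  = ≤-refl
    bit {false} = z≤n
  proper : Proper r Q combine
  proper K (size≡ , _) = replicate r 1
    , subst (IsPartition r) (hook-last 1≤r) (hook-partition (pred1 1≤r)) , R
    , ↭-reflexive (sym (trans (nonzeros-01 (All.tabulate⁺ (≤1 K)))
        (cong (λ s → replicate s 1) (trans (∑-colourCount combine K) size≡))))
    where
    pred1 : 1 ≤ r → r ∸ 1 < r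
    pred1 (s≤s _) = ≤-refl

-- Constraints that a proper colouring puts on `Q`.

take-length : (t : ℕ) (xs : List A) → t ≤ length xs → length (take t xs) ≡ t
take-length t xs le = trans (length-take t xs) (m≤n⇒m⊓n≡m le)

length≤sum : ∀ {xs} → All (1 ≤_) xs → length xs ≤ sum xs
length≤sum []       = z≤n
length≤sum (h ∷ hs) = +-mono-≤ h (length≤sum hs)

all≤sum : ∀ xs → All (_≤ sum xs) xs
all≤sum []       = []
all≤sum (x ∷ xs) = m≤m+n x _ ∷ All.map (λ h → ≤-trans h (m≤n+m _ x)) (all≤sum xs)

allFin-length : ∀ m → length (allFin m) ≡ m
allFin-length m = length-tabulate id

-- In the other alternative of the pigeonhole, `suc k` positions would carry distinct colours, one
-- more than there are.
dominant : (f : Fin q → Fin k) (s : ℕ) → suc k * suc s ≤ q →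
  ∃ λ d → ∃ λ js → Unique js × length js ≡ suc s × All (λ j → f j ≡ d) js
dominant {q} {k} f s le
  with constant⊎separated _≟F_ f s (suc k) (allFin q) (Unique.allFin⁺ q)
         (subst (suc k * suc s ≤_) (sym (allFin-length q)) le)
... | inj₁ found = found
... | inj₂ (ys , len , sep , _) = contradiction (unique-length (AllPairs.map⁺ {f = f} sep))
    (<⇒≱ (≤-reflexive (sym (trans (length-map f ys) len))))

hook-step : ∀ {j r} → j < r → (r ∸ suc j) + 1 ≡ r ∸ j
hook-step {zero}  {suc r} _ = +-comm r 1
hook-step {suc j} {suc r} (s≤s lt) = hook-step lt

module ProperColouring {s : ℕ} (c : Colouring n q k) (uses : UsesAll c)
  (proper : Proper (suc s) Q c) (wide : suc k * suc s ≤ q) where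

  open Blocks c

  r₀ : ℕ
  r₀ = suc s

  dom : ∀ i → _
  dom i = dominant (c i) s wide

  D : Fin n → Fin k
  D i = proj₁ (dom i)

  -- Prefixes of one list of `suc s` positions of colour `D i` serve all sizes up to `r₀`.
  block : Fin n → ℕ → Block
  block i a with dom i
  ... | d , js , u , _ , h = record
    { cls = i ; col = d ; pos = take a js ; unique = Unique.take⁺ a u
    ; mono = All.lookup (All.take⁺ a h) }

  block-mult : ∀ i {a} → a ≤ r₀ → mult (block i a) ≡ a
  block-mult i {a} le with dom i
  ... | d , js , u , len , h = take-length a js (subst (a ≤_) (sym len) le)

  vertex : (i : Fin n) (j : Fin q) (a : Fin k) → c i j ≡ a → Block
  vertex i j a eq = record
    { cls = i ; col = a ; pos = j ∷ [] ; unique = [] ∷ []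
    ; mono = λ { (here refl) → eq } }

  home : Fin k → Fin n
  home a = proj₁ (uses a)

  single : Fin k → Block
  single a = vertex (home a) (proj₁ (proj₂ (uses a))) a (proj₂ (proj₂ (uses a)))

  blocks : List (Fin n) → List ℕ → List Block
  blocks = zipWith block

  blocks-cls : ∀ is ms → length is ≡ length ms → map cls (blocks is ms) ≡ is
  blocks-cls []       []       _  = refl
  blocks-cls (i ∷ is) (a ∷ ms) eq = cong (i ∷_) (blocks-cls is ms (suc-injective eq))

  blocks-col : ∀ is ms → length is ≡ length ms → map col (blocks is ms) ≡ map D is
  blocks-col []       []       _  = refl
  blocks-col (i ∷ is) (a ∷ ms) eq = cong (D i ∷_) (blocks-col is ms (suc-injective eq))

  blocks-mult : ∀ is {ms} → length is ≡ length ms → All (_≤ r₀) ms → map mult (blocks is ms) ≡ ms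
  blocks-mult []       {[]}     _  []       = refl
  blocks-mult (i ∷ is) {a ∷ ms} eq (h ∷ hs) =
    cong₂ _∷_ (block-mult i h) (blocks-mult is (suc-injective eq) hs)

  singles-col : ∀ as → map col (map single as) ≡ as
  singles-col as = trans (sym (map-∘ as)) (map-id as)

  singles-cls : ∀ as → map cls (map single as) ≡ map home as
  singles-cls as = sym (map-∘ as)

  singles-mult : ∀ as → map mult (map single as) ≡ replicate (length as) 1
  singles-mult []       = refl
  singles-mult (a ∷ as) = cong (1 ∷_) (singles-mult as)

  apart-cls : ∀ {bs} → Unique (map cls bs) → AllPairs Apart bs
  apart-cls u = AllPairs.map inj₁ (AllPairs.map⁻ u)

  apart-col : ∀ {bs} → Unique (map col bs) → AllPairs Apart bs
  apart-col u = AllPairs.map inj₂ (AllPairs.map⁻ u)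

  -- The source of all later constraints: `select bs` is an edge because its type `σ` is in `Q`, and
  -- properness then puts its pattern `π` there.
  forced : ∀ {bs σ π} → AllPairs Apart bs → Cls.Counts bs σ → Col.Counts bs π →
    IsPartition r₀ σ → Q σ ≡ true → IsPartition r₀ π → Q π ≡ true
  forced {bs} {σ} {π} ap cσ cπ partσ qσ partπ =
    inSet⇒∈ {Q = Q} (proper K (size≡ , σ , partσ , qσ , ↭-sym (↭-trans (↭-reflexive classes) cσ)))
      (↭-trans (↭-reflexive (cong nonzeros (tabulate-cong (colourCount-select ap)))) cπ) partπ
    where
    K = select bs
    classes : classCounts K ≡ nonzeros (tabulate (Cls.total bs))
    classes = cong nonzeros (tabulate-cong (classCount-select ap))
    size≡ : size K ≡ r₀
    size≡ = begin
      ∑ (λ i → countF (K i))                  ≡⟨ ∑-cong (classCount-select ap) ⟩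
      sum (tabulate (Cls.total bs))           ≡⟨ sum-nonzeros (tabulate (Cls.total bs)) ⟨
      sum (nonzeros (tabulate (Cls.total bs))) ≡⟨ sum-↭ cσ ⟩
      sum σ                                   ≡⟨ proj₂ (proj₂ partσ) ⟩
      r₀                                      ∎
      where open ≡-Reasoning

  forced-one-class : ∀ {bs i π} → All (λ b → cls b ≡ i) bs → Unique (map col bs) →
    Q (r₀ ∷ []) ≡ true → map mult bs ↭ π → IsPartition r₀ π → Q π ≡ true
  forced-one-class {bs} same u M p part@(positive , _ , sum≡) = forced (apart-col u)
    (subst (λ t → Cls.Counts bs (t ∷ [])) total≡
      (Cls.counts-constant same (subst (1 ≤_) (sym total≡) (s≤s z≤n))))
    (↭-trans (Col.counts-unique u (All-resp-↭ (↭-sym p) positive)) p)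
    (hook-partition (s≤s z≤n)) M part
    where
    total≡ : sum (map mult bs) ≡ r₀
    total≡ = trans (sum-↭ p) sum≡

  forced-one-colour : ∀ {bs a σ} → All (λ b → col b ≡ a) bs → Unique (map cls bs) →
    map mult bs ↭ σ → IsPartition r₀ σ → Q σ ≡ true → Q (r₀ ∷ []) ≡ true
  forced-one-colour {bs} same u p part@(positive , _ , sum≡) qσ = forced (apart-cls u)
    (↭-trans (Cls.counts-unique u (All-resp-↭ (↭-sym p) positive)) p)
    (subst (λ t → Col.Counts bs (t ∷ [])) total≡
      (Col.counts-constant same (subst (1 ≤_) (sym total≡) (s≤s z≤n))))
    part qσ (hook-partition (s≤s z≤n))
    where
    total≡ : sum (map mult bs) ≡ r₀
    total≡ = trans (sum-↭ p) sum≡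

  -- `b` and `b′` share a class but not a colour, so they form one part of the type and two parts of
  -- the pattern.
  forced-split : ∀ {b b′ bs x y rest σ π} → cls b ≡ cls b′ →
    Unique (map cls (b′ ∷ bs)) → Unique (map col (b ∷ b′ ∷ bs)) →
    map mult (b ∷ b′ ∷ bs) ≡ x ∷ y ∷ rest →
    σ ↭ x + y ∷ rest → IsPartition r₀ σ → Q σ ≡ true →
    π ↭ x ∷ y ∷ rest → IsPartition r₀ π → Q π ≡ true
  forced-split {b} {b′} {bs} eq u v refl pσ partσ qσ pπ partπ = forced
    (apart-col {b ∷ b′ ∷ bs} v)
    (↭-trans (Cls.counts-pair {b} {b′} {bs} eq u positive) (↭-sym pσ))
    (↭-trans (Col.counts-unique {b ∷ b′ ∷ bs} v positive) (↭-sym pπ)) partσ qσ partπ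
    where positive = All-resp-↭ pπ (proj₁ partπ)

  -- Dual to `forced-split`: two classes, one colour.
  forced-merge : ∀ {b b′ bs x y rest σ π} → col b ≡ col b′ →
    Unique (map cls (b ∷ b′ ∷ bs)) → Unique (map col (b′ ∷ bs)) →
    map mult (b ∷ b′ ∷ bs) ≡ x ∷ y ∷ rest →
    σ ↭ x ∷ y ∷ rest → IsPartition r₀ σ → Q σ ≡ true →
    π ↭ x + y ∷ rest → IsPartition r₀ π → Q π ≡ true
  forced-merge {b} {b′} {bs} eq u v refl pσ partσ qσ pπ partπ = forced
    (apart-cls {b ∷ b′ ∷ bs} u)
    (↭-trans (Cls.counts-unique {b ∷ b′ ∷ bs} u positive) (↭-sym pσ))
    (↭-trans (Col.counts-pair {b} {b′} {bs} eq v positive) (↭-sym pπ)) partσ qσ partπ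
    where positive = All-resp-↭ pσ (proj₁ partσ)

  away : (f : A → Fin m) → Fin m → List A → List A
  away = avoid _≟F_

  -- Class `i` contains every colour in `as`: the edge has `r₀ ∸ j` vertices of the dominant colour
  -- and one of each of `j` others. One colour in `as` may be the dominant one, hence `suc j`.
  one-home : ∀ {i as j} → Unique as → All (λ a → home a ≡ i) as → suc j ≤ length as →
    j < r₀ → Q (r₀ ∷ []) ≡ true → Q (hook r₀ j) ≡ true
  one-home {i} {as} {j} u same long j<r M =
    forced-one-class {bs = block i (r₀ ∸ j) ∷ map single zs}
      (refl ∷ All.map⁺ (All.take⁺ j (All.filter⁺ _ same)))
      (subst (λ l → Unique (D i ∷ l)) (sym (singles-col zs))
        (All.take⁺ j (All.map (_∘ sym) (avoid-All _≟F_ id (D i) as)) ∷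
         Unique.take⁺ j (Unique.filter⁺ _ u)))
      M
      (↭-reflexive (cong₂ _∷_ (block-mult i (m∸n≤m r₀ j))
        (trans (singles-mult zs) (cong (λ t → replicate t 1) len))))
      (hook-partition j<r)
    where
    zs = take j (away id (D i) as)
    len : length zs ≡ j
    len = take-length j _ (≤-pred (≤-trans long (avoid-length _≟F_ id (D i) u)))

  -- Class `A` supplies `r₀ ∸ suc j` vertices of colour `D A` and one of colour `c A p`; `j` single
  -- vertices in new colours come from other classes. The three spare colours in `as` allow for
  -- avoiding `c A p`, `D A` and the class `A`.
  two-coloured-class : ∀ {A p as j} → c A p ≢ D A → Separated home as → 3 + j ≤ length as →
    suc j < r₀ → Q (hook r₀ j) ≡ true → Q (hook r₀ (suc j)) ≡ true
  two-coloured-class {A} {p} {as} {j} e≢ sep long j<r qj =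
    forced-split {b = block A (r₀ ∸ suc j)} {b′ = vertex A p e refl} {bs = map single zs} refl
      (subst (λ l → Unique (A ∷ l)) (sym (singles-cls zs))
        (All.map⁺ (All.take⁺ j (All.map (_∘ sym) (avoid-All _≟F_ home A as₂))) ∷
         AllPairs.map⁺ (AllPairs.take⁺ j (AllPairs.filter⁺ _ sep₂))))
      (subst (λ l → Unique (D A ∷ e ∷ l)) (sym (singles-col zs))
        ( ((e≢ ∘ sym) ∷ All.take⁺ j (All.filter⁺ _ (All.map (_∘ sym) (avoid-All _≟F_ id (D A) as₁))))
        ∷ All.take⁺ j (All.filter⁺ _ (All.filter⁺ _ (All.map (_∘ sym) (avoid-All _≟F_ id e as))))
        ∷ Unique.take⁺ j (Unique.filter⁺ _ (separated⇒unique sep₂))))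
      (cong₂ _∷_ (block-mult A (m∸n≤m r₀ (suc j)))
        (cong (1 ∷_) (trans (singles-mult zs) (cong (λ t → replicate t 1) len))))
      (↭-reflexive (cong (_∷ replicate j 1) (sym (hook-step (<⇒≤ j<r)))))
      (hook-partition (<⇒≤ j<r)) qj ↭-refl (hook-partition j<r)
    where
    e = c A p
    as₁ = away id e as
    as₂ = away id (D A) as₁
    zs = take j (away home A as₂)
    sep₁ : Separated home as₁
    sep₁ = AllPairs.filter⁺ _ sep
    sep₂ : Separated home as₂
    sep₂ = AllPairs.filter⁺ _ sep₁
    len : length zs ≡ j
    len = take-length j _ (≤-pred (≤-pred (≤-pred (≤-trans long
      (≤-trans (avoid-length _≟F_ id e (separated⇒unique sep))
      (s≤s (≤-trans (avoid-length _≟F_ id (D A) (separated⇒unique sep₁))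
      (s≤s (avoid-length _≟F_ home A sep₂)))))))))

  -- The parts in `rest` go to the homes of distinct colours other than `D A`; these suffice because
  -- a partition of `r₀` has at most `r₀` parts.
  monochromatic-classes⇒reductionClosed : (∀ i j → c i j ≡ D i) → ∀ {A B} → A ≢ B → D A ≡ D B →
    suc s < k → ReductionClosed r₀ Q
  monochromatic-classes⇒reductionClosed mono {A} {B} A≢B DA≡DB k>r σ π partσ partπ qσ
    (a , b , rest , pσ , pπ) =
    forced-merge {b = block A a} {b′ = block B b} {bs = blocks (map home zs) rest} DA≡DB
      (subst (λ l → Unique (A ∷ B ∷ l)) (sym (blocks-cls _ rest len))
        ((A≢B ∷ All.map⁺ (All.map (λ ne eq → ne (trans (cong D eq) (D-home _))) DA∉))
        ∷ All.map⁺ (All.map (λ ne eq → ne (trans DA≡DB (trans (cong D eq) (D-home _)))) DA∉)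
        ∷ AllPairs.map⁺ (AllPairs.map
            (λ ne eq → ne (trans (sym (D-home _)) (trans (cong D eq) (D-home _)))) uniq)))
      (subst (λ l → Unique (D B ∷ l)) (sym (trans (blocks-col _ rest len) cols))
        (subst (λ d → All (d ≢_) zs) DA≡DB DA∉ ∷ uniq))
      (mults bounds)
      pσ partσ qσ pπ partπ
    where
    free = away id (D A) (allFin k)
    zs = take (length rest) free
    -- The home of `a` is monochromatic and contains the colour `a`. Hence distinct colours have
    -- distinct homes.
    D-home : ∀ a → D (home a) ≡ a
    D-home a = trans (sym (mono (home a) _)) (proj₂ (proj₂ (uses a)))
    parts : All (1 ≤_) (a ∷ b ∷ rest)
    parts = All-resp-↭ pσ (proj₁ partσ)
    sum≡ : sum (a ∷ b ∷ rest) ≡ r₀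
    sum≡ = trans (sym (sum-↭ pσ)) (proj₂ (proj₂ partσ))
    bounds : All (_≤ r₀) (a ∷ b ∷ rest)
    bounds = subst (λ t → All (_≤ t) (a ∷ b ∷ rest)) sum≡ (all≤sum (a ∷ b ∷ rest))
    uniq : Unique zs
    uniq = Unique.take⁺ (length rest) (Unique.filter⁺ _ (Unique.allFin⁺ k))
    DA∉ : All (D A ≢_) zs
    DA∉ = All.take⁺ (length rest) (All.map (_∘ sym) (avoid-All _≟F_ id (D A) (allFin k)))
    enough : length rest ≤ length free
    enough = ≤-pred (begin
      suc (length rest)       ≤⟨ n≤1+n _ ⟩
      length (a ∷ b ∷ rest)   ≤⟨ length≤sum parts ⟩
      sum (a ∷ b ∷ rest)      ≡⟨ sum≡ ⟩
      r₀                      ≤⟨ <⇒≤ k>r ⟩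
      k                       ≡⟨ allFin-length k ⟨
      length (allFin k)       ≤⟨ avoid-length _≟F_ id (D A) (Unique.allFin⁺ k) ⟩
      suc (length free)       ∎)
      where open ≤-Reasoning
    len : length (map home zs) ≡ length rest
    len = trans (length-map home zs) (take-length (length rest) free enough)
    cols : map D (map home zs) ≡ zs
    cols = trans (sym (map-∘ zs)) (trans (map-cong D-home zs) (map-id zs))
    mults : All (_≤ r₀) (a ∷ b ∷ rest) →
      map mult (block A a ∷ block B b ∷ blocks (map home zs) rest) ≡ a ∷ b ∷ rest
    mults (ha ∷ hb ∷ hs) = cong₂ _∷_ (block-mult A ha)
      (cong₂ _∷_ (block-mult B hb) (blocks-mult _ len hs))

  -- One vertex of the dominant colour from each class in `is` gives an edge of type R and pattern
  -- M.
  constant-dominants : ∀ {is d} → Unique is → length is ≡ r₀ → All (λ i → D i ≡ d) is →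
    Q (replicate r₀ 1) ≡ true → Q (r₀ ∷ []) ≡ true
  constant-dominants {is} u len same R =
    forced-one-colour {bs = blocks is ones}
      (All.map⁻ (subst (All (_≡ _)) (sym (blocks-col is ones len′)) (All.map⁺ same)))
      (subst Unique (sym (blocks-cls is ones len′)) u)
      (↭-reflexive (blocks-mult is len′ (All.replicate⁺ r₀ (s≤s z≤n))))
      (subst (IsPartition r₀) (hook-last {r₀} (s≤s z≤n)) (hook-partition {r₀} {s} ≤-refl)) R
    where
    ones = replicate r₀ 1
    len′ : length is ≡ length ones
    len′ = trans len (sym (length-replicate r₀))

  -- `A` takes the long part of the hook and `B` a part 1; they merge into `r₀ ∸ j`. The other ones
  -- go to classes whose dominant colours differ from `D A`, at the cost of at most one class in
  -- `is`.
  separated-dominants : ∀ {A B is j} → A ≢ B → D A ≡ D B → Separated D is → suc j ≤ length is →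
    suc j < r₀ → Q (hook r₀ (suc j)) ≡ true → Q (hook r₀ j) ≡ true
  separated-dominants {A} {B} {is} {j} A≢B DA≡DB sep long j<r qj =
    forced-merge {b = block A (r₀ ∸ suc j)} {b′ = block B 1} {bs = blocks zs ones} DA≡DB
      (subst (λ l → Unique (A ∷ B ∷ l)) (sym (blocks-cls zs ones len))
        ((A≢B ∷ All.map (λ ne → ne ∘ cong D) DA∉)
        ∷ All.map (λ ne eq → ne (trans DA≡DB (cong D eq))) DA∉
        ∷ separated⇒unique sep′))
      (subst (λ l → Unique (D B ∷ l)) (sym (blocks-col zs ones len))
        (All.map⁺ (subst (λ d → All (λ i → d ≢ D i) zs) DA≡DB DA∉) ∷ AllPairs.map⁺ sep′))
      (cong₂ _∷_ (block-mult A (m∸n≤m r₀ (suc j)))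
        (cong₂ _∷_ (block-mult B (s≤s z≤n)) (blocks-mult zs len (All.replicate⁺ j (s≤s z≤n)))))
      ↭-refl (hook-partition j<r) qj
      (↭-reflexive (cong (_∷ ones) (sym (hook-step (<⇒≤ j<r))))) (hook-partition (<⇒≤ j<r))
    where
    ones = replicate j 1
    zs = take j (away D (D A) is)
    DA∉ : All (λ i → D A ≢ D i) zs
    DA∉ = All.take⁺ j (All.map (_∘ sym) (avoid-All _≟F_ D (D A) is))
    sep′ : Separated D zs
    sep′ = AllPairs.take⁺ j (AllPairs.filter⁺ _ sep)
    len : length zs ≡ length ones
    len = trans (take-length j _ (≤-pred (≤-trans long (avoid-length _≟F_ D (D A) sep))))
                (sym (length-replicate j))

  -- The home `h` of `e` has another dominant colour. A vertex of colour `e` beside `a` dominant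
  -- ones in `h` turns the part `suc a` into `a` and 1, and injectivity keeps the colours of the
  -- other parts distinct.
  injective-dominants⇒expansionClosed : (∀ {i j} → D i ≡ D j → i ≡ j) →
    ∀ e → (∀ i → D i ≢ e) → suc s ≤ n → ExpansionClosed r₀ Q
  injective-dominants⇒expansionClosed D-inj e e∉ r≤n σ π partσ partπ qσ
    (suc a , rest , s≤s 1≤a , pσ , pπ) =
    forced-split {b = block h a} {b′ = single e} {bs = blocks zs rest} refl
      (subst (λ l → Unique (h ∷ l)) (sym (blocks-cls zs rest len)) (h∉ ∷ uniq))
      (subst (λ l → Unique (D h ∷ e ∷ l)) (sym (blocks-col zs rest len))
        ((e∉ h ∷ All.map⁺ (All.map (λ ne → ne ∘ D-inj) h∉))
        ∷ All.map⁺ (All.universal (λ i → e∉ i ∘ sym) zs)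
        ∷ Unique.map⁺ D-inj uniq))
      (mults bounds)
      (↭-trans pσ (↭-reflexive (cong (_∷ rest) (sym (+-comm a 1))))) partσ qσ pπ partπ
    where
    h = home e
    free = away id h (allFin n)
    zs = take (length rest) free
    sum≡ : sum (suc a ∷ rest) ≡ r₀
    sum≡ = trans (sym (sum-↭ pσ)) (proj₂ (proj₂ partσ))
    bounds : All (_≤ r₀) (suc a ∷ rest)
    bounds = subst (λ t → All (_≤ t) (suc a ∷ rest)) sum≡ (all≤sum (suc a ∷ rest))
    uniq : Unique zs
    uniq = Unique.take⁺ (length rest) (Unique.filter⁺ _ (Unique.allFin⁺ n))
    h∉ : All (h ≢_) zs
    h∉ = All.take⁺ (length rest) (All.map (_∘ sym) (avoid-All _≟F_ id h (allFin n)))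
    enough : length rest ≤ length free
    enough = ≤-pred (begin
      length (suc a ∷ rest)   ≤⟨ length≤sum (All-resp-↭ pσ (proj₁ partσ)) ⟩
      sum (suc a ∷ rest)      ≡⟨ sum≡ ⟩
      r₀                      ≤⟨ r≤n ⟩
      n                       ≡⟨ allFin-length n ⟨
      length (allFin n)       ≤⟨ avoid-length _≟F_ id h (Unique.allFin⁺ n) ⟩
      suc (length free)       ∎)
      where open ≤-Reasoning
    len : length zs ≡ length rest
    len = take-length (length rest) free enough
    mults : All (_≤ r₀) (suc a ∷ rest) →
      map mult (block h a ∷ single e ∷ blocks zs rest) ≡ a ∷ 1 ∷ rest
    mults (a≤ ∷ rest≤) = cong₂ _∷_ (block-mult h (<⇒≤ a≤)) (cong (1 ∷_) (blocks-mult zs len rest≤))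

-- The three cases and the choice of parameters.

-- Otherwise choosing preimages would inject `Fin (suc n)` into `Fin n`.
missed-value : (f : Fin n → Fin (suc n)) → ∃ λ e → ∀ i → f i ≢ e
missed-value {n} f with any? (λ e → all? (λ i → ¬? (f i ≟F e)))
... | yes found = found
... | no none = contradiction (injective⇒≤ section-injective) 1+n≰n
  where
  preimage : ∀ e → ∃ λ i → f i ≡ e
  preimage e with ¬∀⟶∃¬ n _ (λ i → ¬? (f i ≟F e)) (λ h → none (e , h))
  ... | i , ¬¬eq = i , decidable-stable (f i ≟F e) ¬¬eq
  section-injective : ∀ {a b} → proj₁ (preimage a) ≡ proj₁ (preimage b) → a ≡ b
  section-injective {a} {b} eq =
    trans (sym (proj₂ (preimage a))) (trans (cong f eq) (proj₂ (preimage b)))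

module _ {s : ℕ} {Q : PSet} where

  one-class⇒simplyClosed : Q (suc s ∷ []) ≡ true →
    InSpectrum 1 (suc s) ((2 + s) * suc s) Q Q (suc s) → SimplyClosed (suc s) Q
  one-class⇒simplyClosed M (c , uses , proper) j j<r =
    one-home (Unique.allFin⁺ (suc s)) (All.universal (λ a → only (home a)) (allFin (suc s)))
      (subst (suc j ≤_) (sym (allFin-length (suc s))) j<r) j<r M
    where
    open ProperColouring {s = s} c uses proper ≤-refl
    only : (i : Fin 1) → i ≡ zero
    only zero = refl

  fewer-colours⇒reductionClosed : ∀ {k q} → (2 + suc s) * suc s ≤ k → suc k * suc s ≤ q →
    Q (suc s ∷ []) ≡ true → Q (replicate (suc s) 1) ≢ true →
    InSpectrum (suc k) (suc s) q Q Q k → ReductionClosed (suc s) Q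
  fewer-colours⇒reductionClosed {k} {q} large wide M R (c , uses , proper)
    with first-change (λ j → Q (hook (suc s) j)) true s M
           (λ e → R (trans (sym (cong Q (hook-last {suc s} (s≤s z≤n)))) e))
  ... | j , j<s , qj , ¬qj =
    decide (any? λ i → any? λ p → ¬? (c i p ≟F D i))
    where
    open ProperColouring {s = s} c uses proper wide
    decide : Dec (∃ λ i → ∃ λ p → c i p ≢ D i) → ReductionClosed (suc s) Q
    decide (yes (i , p , two)) = contradiction hook-in ¬qj
      where
      hook-in : Q (hook (suc s) (suc j)) ≡ true
      -- Either one class is the home of `suc s` colours, or `2 + suc s` colours have distinct
      -- homes; as `j < s`, both numbers meet the demands of the lemmas applied.
      hook-in with constant⊎separated _≟F_ home s (2 + suc s) (allFin k) (Unique.allFin⁺ k)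
                     (subst ((2 + suc s) * suc s ≤_) (sym (allFin-length k)) large)
      ... | inj₁ (_ , as , u , len , same) =
        one-home u same (subst (2 + j ≤_) (sym len) (s≤s j<s)) (s≤s j<s) M
      ... | inj₂ (as , len , sep , _) =
        two-coloured-class {p = p} two sep
          (subst (3 + j ≤_) (sym len) (s≤s (s≤s (m≤n⇒m≤1+n j<s)))) (s≤s j<s) qj
    decide (no mono) with pigeonhole (n<1+n k) D
    ... | a , b , a<b , eq = monochromatic-classes⇒reductionClosed
      (λ i p → decidable-stable (c i p ≟F D i) (λ ne → mono (i , p , ne)))
      (<⇒≢F a<b) eq (≤-trans (m<m+n (suc s) (s≤s z≤n)) large)

  more-colours⇒expansionClosed : ∀ {n q} → suc s * suc s ≤ n → suc (suc n) * suc s ≤ q →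
    Q (suc s ∷ []) ≢ true → Q (replicate (suc s) 1) ≡ true →
    InSpectrum n (suc s) q Q Q (suc n) → ExpansionClosed (suc s) Q
  more-colours⇒expansionClosed {n} {q} large wide M R (c , uses , proper)
    -- The change is now from `false` to `true`: of the two hooks, the one with more ones is in `Q`.
    with first-change (λ j → Q (hook (suc s) j)) false s (¬-not M)
           (not-¬ (trans (cong Q (hook-last {suc s} (s≤s z≤n))) R))
  ... | j , j<s , ¬qj , qj =
    decide (any? λ a → any? λ b → ¬? (a ≟F b) ×-dec D a ≟F D b)
    where
    open ProperColouring {s = s} c uses proper wide
    decide : Dec (∃ λ a → ∃ λ b → a ≢ b × D a ≡ D b) → ExpansionClosed (suc s) Q
    decide (yes (a , b , a≢b , eq))
      -- Either `suc s` classes share a dominant colour, which would put M into `Q`, or `suc s`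
      -- classes have distinct ones, which would put `hook (suc s) j` there.
      with constant⊎separated _≟F_ D s (suc s) (allFin n) (Unique.allFin⁺ n)
             (subst (suc s * suc s ≤_) (sym (allFin-length n)) large)
    ... | inj₁ (_ , is , u , len , same) = contradiction (constant-dominants u len same R) M
    ... | inj₂ (is , len , sep , _) = contradiction
      (separated-dominants a≢b eq sep (subst (suc j ≤_) (sym len) (m≤n⇒m≤1+n j<s)) (s≤s j<s) (¬-not qj))
      (not-¬ ¬qj)
    decide (no inj) with missed-value D
    ... | e , e∉ = injective-dominants⇒expansionClosed
      (λ {a} {b} eq → decidable-stable (a ≟F b) (λ ne → inj (a , b , ne , eq))) e e∉
      (≤-trans (m≤m*n (suc s) (suc s)) large)

theorem4p2 : (r : ℕ) → 2 ≤ r → (Q : PSet) →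
    (Q (r ∷ []) ≡ true ⊎ Q (replicate r 1) ≡ true) → ¬ Robust r Q →
    Σ ℕ λ n → Σ ℕ λ q → Σ PSet λ Sig →
    1 ≤ n × 1 ≤ q × HasGap n r q Sig Q
theorem4p2 r@(suc s) 2≤r Q M⊎R ¬robust
  with Q (r ∷ []) Bool.≟ true | Q (replicate r 1) Bool.≟ true
... | yes M | yes R =
  1 , width , Q , s≤s z≤n , s≤s z≤n , 1 , r , 1 * width , 2≤r , r<width
  , constant-spectrum (s≤s z≤n) M
  , (λ in-r → ¬robust (inj₂ (inj₂ (one-class⇒simplyClosed M in-r))))
  , rainbow-spectrum 1 width (s≤s z≤n) R
  where
  -- The bound that guarantees dominant colours when there are `r` colours.
  width = suc r * r
  r<width : r < 1 * width
  r<width = subst (r <_) (sym (*-identityˡ width)) (m<m+n r (s≤s z≤n))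
... | yes M | no ¬R =
  suc colours , suc colours * r , Q , s≤s z≤n , s≤s z≤n , 1 ,
  colours , suc colours , 1<colours , n<1+n colours
  , constant-spectrum (s≤s z≤n) M
  , (λ in-k → ¬robust (inj₁ (fewer-colours⇒reductionClosed ≤-refl ≤-refl M ¬R in-k)))
  , class-spectrum
  where
  -- Enough for the pigeonhole on homes: `r` colours with a common home or `2 + r` with distinct
  -- ones.
  colours = (2 + r) * r
  1<colours : 1 < colours
  1<colours = ≤-trans 2≤r (m≤m+n r _)
... | no ¬M | yes R =
  classes , width , Q , s≤s z≤n , s≤s z≤n ,
  classes , suc classes , classes * width , n<1+n classes , n<nq
  , class-spectrum
  , (λ in-n+1 → ¬robust (inj₂ (inj₁ (more-colours⇒expansionClosed ≤-refl ≤-refl ¬M R in-n+1))))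
  , rainbow-spectrum classes width (s≤s z≤n) R
  where
  -- Enough for the pigeonhole on dominant colours; `width` is the bound for `suc classes` colours.
  classes = r * r
  width = suc (suc classes) * r
  n<nq : suc classes < classes * width
  n<nq = ≤-trans (m≤m*n (2 + classes) r) (m≤n*m width classes)
... | no ¬M | no ¬R with M⊎R
... | inj₁ M = contradiction M ¬M
... | inj₂ R = contradiction R ¬R
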